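{- Let $0\leq\varepsilon_c<\varepsilon_f\leq1$, $g=\varepsilon_f-\varepsilon_c$, $\rho,\gamma\in[0,1]$, and $\kappa=\rho+(1-\rho)\gamma$. Fix a constant $c<1/2$ and suppose that $\kappa\leq cg$. For every fixed error probability, Protocol $\Pi_{\mathrm{mis}}^{\mathrm{BB}}$ (described in the context) uses $O(1/g^2)$ honest-prover evaluations and $O(1/g)$ verifier evaluations. The hidden constants are proportional to $(1-2c)^{ -2}$.
   Context: Fix an integer $K\ge1$; $\mathcal{S}_K=\{0,1/K,\dots,1\}$. $D$ is a distribution over a finite domain $\mathcal{X}$ and $f_P,f_V\colon\mathcal{X}\to\mathcal{S}_K$ are the prover-side and verifier-side evaluation functions. They are promised to have bounded $(\rho,\gamma)$-mismatch with respect to $D$: there is $B\subseteq\mathcal{X}$ with $D(B)\le\rho$ and $|f_P(x)-f_V(x)|\le\gamma$ for all $x\notin B$. The verifier samples from $D$ and queries $f_V$; the honest prover queries $f_P$. Honest-prover evaluations are queries to $f_P$; verifier evaluations are queries to $f_V$. $\sigma\in[0,1]$ is the claimed value of $\mathbb{E}_{X\sim D}[f_P(X)]$, $\delta\in(0,1/3)$ the error probability (bounding both completeness and soundness errors), and $\eta:=g-2\kappa$. Randomized comparison: for $a,b\in\mathcal{S}_K$ and $U\in[K]$, $C_K(a,b;U):=\mathbf{1}\bigl[\mathbf{1}[U\le Ka]\ne\mathbf{1}[U\le Kb]\bigr]$. Descent: $\mathcal{T}_m$ is the balanced binary interval tree over $[m]$ with root $[m]$; every nonsingleton interval $I$ has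 consecutive children $I_0,I_1$ whose sizes differ by at most one. $\mathcal{W}_K(I):=\{z/K:z\in\{0,\dots,K|I|\}\}$. In one descent rooted at claim $W$, the verifier privately samples $J$ uniform in $[m]$ and follows the path from the root to $\{J\}$; at each interval $I$ on the path the prover sends claims for both children before the verifier reveals which child contains $J$; the verifier checks that each child claim is in $\mathcal{W}_K(I_b)$ (range) and that they sum to the claim of $I$ (additivity), and continues with the child containing $J$. Protocol $\Pi_{\mathrm{mis}}^{\mathrm{BB}}$: set $a:=\eta/8$, $m:=\lceil 32\ln(12/\delta)/\eta^2\rceil$, $q:=\lceil 24g\ln(12/\delta)/\eta^2\rceil$. (1) The verifier draws independent $X_1,\dots,X_m\sim D$ and sends the ordered sample. (2) The honest prover sets $p_j:=f_P(X_j)$ (querying each distinct point once) and sends $W:=\sum_jp_j$. (3) The verifier rejects unless $W\in\mathcal{W}_K([m])$ and $|W/m-\sigma|\le\varepsilon_c+a$. (4) The parties perform $q$ sequential descents of $\mathcal{T}_m$, each rooted at $W$ with fresh index $J_t$ (the honest prover sends true partial sums of stored values). If a range or additivity check fails, the verifier rejects. Otherwise descent $t$ reaches $\{J_t\}$ with claim $A_t$; the verifier queries $V_t:=f_V(X_{J_t})$, draws a fresh uniform $U_t\in[K]$, and sets $Z_t:=C_K(A_t,V_t;U_t)$. (5) If no check failed, the verifier accepts iff $\sum_{t=1}^qZ_t\le gq/2$. -}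

module Defs where

open import Level using (0ℓ)
open import Algebra.Apartness.Bundles
  using (HeytingCommutativeRing; HeytingField)
open import Algebra.Bundles using (CommutativeRing)
import Algebra.Apartness.Properties.HeytingCommutativeRing as HeytingProperties
import Algebra.Properties.Ring as RingProperties
import Algebra.Properties.Monoid.Mult as Mult
import Algebra.Properties.Semiring.Exp as Exp
import Algebra.Properties.Semiring.Sum as Sum
open import Data.Bool.Base using (Bool; true; false; if_then_else_; _xor_)
open import Data.Empty using (⊥-elim)
open import Data.Fin.Base using (Fin; toℕ; splitAt)
open import Data.Fin.Properties using () renaming (_≟_ to _≟ᶠ_)
open import Data.Fin.Subset using (Subset; _∉_)
open import Data.Fin.Subset.Properties using (_∈?_)
open import Data.Integer.Base using (ℤ; +_; -[1+_])
open import Data.Maybe.Base using (Maybe; just; nothing)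
open import Data.Nat.Base as ℕ using (ℕ; zero; suc; NonZero; _!; ∣_-_∣)
open import Data.Nat.Properties using (_!≢0)
open import Data.Product.Base using (Σ; ∃; _×_; _,_; proj₁; proj₂)
open import Data.Rational.Base as ℚ using (ℚ; 0ℚ; ½; ↥_; ↧ₙ_; _/_)
import Data.Rational.Properties as ℚₚ
open import Data.Sum.Base using (_⊎_; inj₁; inj₂)
open import Data.Vec.Base using (Vec; []; _∷_; map; foldr′; lookup; take; drop)
open import Function.Base using (_∘_)
open import Relation.Binary.Construct.Closure.ReflexiveTransitive using (Star)
open import Relation.Binary.PropositionalEquality.Core using (_≡_)
open import Relation.Binary.Structures using (IsStrictPartialOrder)
open import Relation.Nullary using (¬_; does)
open import Relation.Nullary.Negation.Core using (contradiction)

------------------------------------------------------------------------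
-- The real numbers

-- An Archimedean, Cauchy-complete ordered field; classically this
-- determines ℝ up to isomorphism.  The order is not assumed decidable, so
-- that constructive models qualify as well.
record Reals : Set₁ where
  infix 4 _<_ _≤_

  field
    heytingField : HeytingField 0ℓ 0ℓ 0ℓ

  open HeytingField heytingField public

  field
    _<_                  : Carrier → Carrier → Set
    isStrictPartialOrder : IsStrictPartialOrder _≈_ _<_
    #⇒<⊎>                : ∀ {x y} → x # y → x < y ⊎ y < x
    <⇒#                  : ∀ {x y} → x < y → x # y
    +-monoˡ-<            : ∀ z {x y} → x < y → x + z < y + z
    *-pos                : ∀ {x y} → 0# < x → 0# < y → 0# < x * y

  _≤_ : Carrier → Carrier → Set
  x ≤ y = ¬ (y < x)

  commutativeRing : CommutativeRing 0ℓ 0ℓ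
  commutativeRing = HeytingCommutativeRing.commutativeRing heytingCommutativeRing

  open CommutativeRing commutativeRing public
    using (ring; semiring; +-monoid)

  open Mult +-monoid using () renaming (_×_ to _·_)

  fromℕ : ℕ → Carrier
  fromℕ n = n · 1#

  -- ∣ x ∣≤ y  and  ∣ x ∣< y  express the bounds |x| ≤ y and |x| < y.
  infix 4 ∣_∣≤_ ∣_∣<_

  ∣_∣≤_ : Carrier → Carrier → Set
  ∣ x ∣≤ y = - y ≤ x × x ≤ y

  ∣_∣<_ : Carrier → Carrier → Set
  ∣ x ∣< y = - y < x × x < y

  _⟶_ : (ℕ → Carrier) → Carrier → Set
  s ⟶ l = ∀ ε → 0# < ε → ∃ λ N → ∀ n → N ℕ.≤ n → ∣ s n - l ∣< ε

  Cauchy : (ℕ → Carrier) → Set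
  Cauchy s = ∀ ε → 0# < ε →
    ∃ λ N → ∀ m n → N ℕ.≤ m → N ℕ.≤ n → ∣ s m - s n ∣< ε

  field
    archimedean : ∀ x → ∃ λ n → x < fromℕ n
    complete    : ∀ s → Cauchy s → ∃ λ l → s ⟶ l

module RealOperations (ℝ : Reals) where
  open Reals ℝ
  open Exp semiring using (_^_)
  open Sum semiring using (sum)
  open IsStrictPartialOrder isStrictPartialOrder
    using (irrefl; <-respˡ-≈; <-respʳ-≈) renaming (trans to <-trans)
  open HeytingProperties
    heytingCommutativeRing using (1#0; x-0≈x)
  open RingProperties ring using (-‿distribˡ-*; -‿distribʳ-*; -‿involutive)

  0<1 : 0# < 1#
  0<1 with #⇒<⊎> 1#0
  ... | inj₂ p = p
  ... | inj₁ p = <-respʳ-≈ -1*-1≈1 (*-pos 0<-1 0<-1)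
    where
    0<-1 : 0# < - 1#
    0<-1 = <-respˡ-≈ (-‿inverseʳ 1#) (<-respʳ-≈ (+-identityˡ (- 1#))
             (+-monoˡ-< (- 1#) p))
    -1*-1≈1 : - 1# * - 1# ≈ 1#
    -1*-1≈1 = trans (sym (-‿distribˡ-* 1# (- 1#)))
              (trans (-‿cong (*-identityˡ (- 1#))) (-‿involutive 1#))

  +-mono-< : ∀ {w x y z} → w < x → y < z → w + y < x + z
  +-mono-< {w} {x} {y} {z} w<x y<z =
    <-trans (+-monoˡ-< y w<x)
      (<-respˡ-≈ (+-comm y x) (<-respʳ-≈ (+-comm z x) (+-monoˡ-< x y<z)))

  fromℕ-pos : ∀ n → .{{NonZero n}} → 0# < fromℕ n
  fromℕ-pos (suc zero)        = <-respʳ-≈ (sym (+-identityʳ 1#)) 0<1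
  fromℕ-pos (suc n@(suc _)) =
    <-respˡ-≈ (+-identityˡ 0#) (+-mono-< 0<1 (fromℕ-pos n))

  recip : ∀ x → 0# < x → Carrier
  recip x 0<x = proj₁ (#⇒invertible (#-sym (<⇒# 0<x)))

  infixl 7 _÷_[_]

  _÷_[_] : ∀ x y → 0# < y → Carrier
  x ÷ y [ 0<y ] = x * recip y 0<y

  recip-inverse : ∀ x (0<x : 0# < x) → recip x 0<x * x ≈ 1#
  recip-inverse x 0<x = trans (*-congˡ (sym (x-0≈x x)))
    (proj₁ (proj₂ (#⇒invertible (#-sym (<⇒# 0<x)))))

  fromℤ : ℤ → Carrier
  fromℤ (+ n)      = fromℕ n
  fromℤ (-[1+ n ]) = - fromℕ (suc n)

  fromℚ : ℚ → Carrier
  fromℚ p = fromℤ (↥ p) ÷ fromℕ (↧ₙ p) [ fromℕ-pos (↧ₙ p) ]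

  -- n = ⌈ x ⌉
  IsCeiling : Carrier → ℕ → Set
  IsCeiling x n = x ≤ fromℕ n × fromℕ n < x + 1#

  expSum : Carrier → ℕ → Carrier
  expSum x n = sum {n} λ i →
    (x ^ toℕ i) ÷ fromℕ (toℕ i !) [ fromℕ-pos (toℕ i !) {{toℕ i !≢0}} ]

  -- y = ln x, with the logarithm being the inverse of exp x = ∑ xᵏ/k!
  IsLn : Carrier → Carrier → Set
  IsLn x y = expSum y ⟶ x

  ≤-<-trans : ∀ {x y z} → x ≤ y → y < z → x < z
  ≤-<-trans {x} {y} {z} x≤y y<z with #-cotrans (<⇒# y<z) x
  ... | inj₁ y#x with #⇒<⊎> y#x
  ...   | inj₁ y<x = contradiction y<x x≤y
  ...   | inj₂ x<y = <-trans x<y y<z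
  ≤-<-trans {x} {y} {z} x≤y y<z | inj₂ x#z with #⇒<⊎> x#z
  ...   | inj₁ x<z = x<z
  ...   | inj₂ z<x = contradiction (<-trans y<z z<x) x≤y

  x<y⇒0<y-x : ∀ {x y} → x < y → 0# < y - x
  x<y⇒0<y-x {x} x<y = <-respˡ-≈ (-‿inverseʳ x) (+-monoˡ-< (- x) x<y)

  0<y-x⇒x<y : ∀ {x y} → 0# < y - x → x < y
  0<y-x⇒x<y {x} {y} p = <-respˡ-≈ (+-identityˡ x) (<-respʳ-≈
    (trans (+-assoc y (- x) x) (trans (+-congˡ (-‿inverseˡ x)) (+-identityʳ y)))
    (+-monoˡ-< x p))

  *-monoˡ-<-pos : ∀ {x y z} → 0# < z → x < y → x * z < y * z
  *-monoˡ-<-pos {x} {y} {z} 0<z x<y = 0<y-x⇒x<y (<-respʳ-≈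
    (trans (distribʳ z y (- x)) (+-congˡ (sym (-‿distribˡ-* x z))))
    (*-pos (x<y⇒0<y-x x<y) 0<z))

  2* : ∀ x → fromℕ 2 * x ≈ x + x
  2* x = trans (*-congʳ (+-congˡ (+-identityʳ 1#)))
         (trans (distribʳ x 1# 1#) (+-cong (*-identityˡ x) (*-identityˡ x)))

  ½+½≈1 : fromℚ ½ + fromℚ ½ ≈ 1#
  ½+½≈1 = trans (sym (2* (fromℚ ½))) (trans (*-congˡ (*-congʳ (+-identityʳ 1#)))
    (trans (*-congˡ (*-identityˡ _))
    (trans (*-comm _ _) (recip-inverse (fromℕ 2) (fromℕ-pos 2)))))

  1-2c-pos : ∀ {c} → c < fromℚ ½ → 0# < 1# - fromℕ 2 * c
  1-2c-pos {c} c<½ = x<y⇒0<y-x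
    (<-respˡ-≈ (sym (2* c)) (<-respʳ-≈ ½+½≈1 (+-mono-< c<½ c<½)))

  g-2κ-pos : ∀ {c g κ} → c < fromℚ ½ → 0# < g → κ ≤ c * g →
           0# < g - fromℕ 2 * κ
  g-2κ-pos {c} {g} {κ} c<½ 0<g κ≤cg = x<y⇒0<y-x
    (<-respˡ-≈ (sym (2* κ)) (<-respʳ-≈ ½g+½g≈g (+-mono-< κ<½g κ<½g)))
    where
    κ<½g : κ < fromℚ ½ * g
    κ<½g = ≤-<-trans κ≤cg (*-monoˡ-<-pos 0<g c<½)
    ½g+½g≈g : fromℚ ½ * g + fromℚ ½ * g ≈ g
    ½g+½g≈g = trans (sym (distribʳ g _ _))
              (trans (*-congʳ ½+½≈1) (*-identityˡ g))

------------------------------------------------------------------------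
-- Scores and randomized comparison

-- The index i stands for the element i / K of {0, 1/K, …, 1}.
𝒮 : ℕ → Set
𝒮 K = Fin (suc K)

val : ∀ K → .{{NonZero K}} → 𝒮 K → ℚ
val K i = + toℕ i / K

-- w lies in 𝒲_K(I) for an interval I with n elements.
InRange : ∀ K → .{{NonZero K}} → ℕ → ℚ → Set
InRange K n w = ∃ λ z → z ℕ.≤ K ℕ.* n × w ≡ + z / K

-- u : Fin K stands for the element 1 + toℕ u of [K] = {1, …, K}.
compare : ∀ K → ℚ → ℚ → Fin K → ℕ
compare K a b u = if below a xor below b then 1 else 0
  where
  below : ℚ → Bool
  below x = does ((+ suc (toℕ u) / 1) ℚₚ.≤? ((+ K / 1) ℚ.* x))

------------------------------------------------------------------------
-- Balanced interval trees

-- A tree over an interval of n points; the points are named by their offset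
-- from the left end, and the left child consists of the first a of them.
-- Which child of an odd interval is the larger one is left open.
data BalancedTree : ℕ → Set where
  leaf : BalancedTree 1
  node : ∀ {a b} → ∣ a - b ∣ ℕ.≤ 1 →
         BalancedTree a → BalancedTree b → BalancedTree (a ℕ.+ b)

size-nonZero : ∀ {n} → BalancedTree n → NonZero n
size-nonZero leaf                   = _
size-nonZero (node {suc _}  _ _ _)  = _
size-nonZero (node {zero}   _ l _)  = ⊥-elim (NonZero.nonZero (size-nonZero l))

------------------------------------------------------------------------
-- Interactive oracle programs

data Child : Set where
  left right : Child

-- Messages for domain X and sample size m.
data VerifierMessage (X : Set) (m : ℕ) : Set where
  sample : Vec X m → VerifierMessage X m
  reveal : Child → VerifierMessage X m

data ProverMessage : Set where
  root     : ℚ → ProverMessage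
  children : ℚ → ℚ → ProverMessage

-- Provers are deterministic: bounds that hold for every prover also hold
-- after a randomized one has fixed its coins.
data Prover (X S : Set) (m : ℕ) : Set where
  stop  : Prover X S m
  query : X → (S → Prover X S m) → Prover X S m
  hear  : (VerifierMessage X m → Prover X S m) → Prover X S m
  say   : ProverMessage → Prover X S m → Prover X S m

data Verifier (X S : Set) (m : ℕ) : Set₁ where
  accept reject : Verifier X S m
  draw    : (X → Verifier X S m) → Verifier X S m
  uniform : ∀ n → (Fin n → Verifier X S m) → Verifier X S m
  query   : X → (S → Verifier X S m) → Verifier X S m
  test    : Set → Verifier X S m → Verifier X S m → Verifier X S m
  tell    : VerifierMessage X m → Verifier X S m → Verifier X S m
  listen  : (ProverMessage → Verifier X S m) → Verifier X S m

-- A joint state of the two parties, with the numbers of evaluations made so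
-- far by the prover and by the verifier.
record State (X S : Set) (m : ℕ) : Set₁ where
  constructor ⟨_,_,_,_⟩
  field
    prover        : Prover X S m
    verifier      : Verifier X S m
    proverEvals   : ℕ
    verifierEvals : ℕ

-- One step of an interaction in which draw samples a point satisfying
-- Support, and the prover and the verifier query fP and fV respectively.
data Step {X S : Set} {m : ℕ} (Support : X → Set) (fP fV : X → S) :
          State X S m → State X S m → Set₁ where
  draw    : ∀ {P k i j} x → Support x →
            Step Support fP fV ⟨ P , draw k , i , j ⟩ ⟨ P , k x , i , j ⟩
  uniform : ∀ {P n k i j} u →
            Step Support fP fV ⟨ P , uniform n k , i , j ⟩ ⟨ P , k u , i , j ⟩
  pass    : ∀ {P A V W i j} → A →
            Step Support fP fV ⟨ P , test A V W , i , j ⟩ ⟨ P , V , i , j ⟩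
  fail    : ∀ {P A V W i j} → ¬ A →
            Step Support fP fV ⟨ P , test A V W , i , j ⟩ ⟨ P , W , i , j ⟩
  queryP  : ∀ {x k V i j} →
            Step Support fP fV ⟨ query x k , V , i , j ⟩
                               ⟨ k (fP x) , V , suc i , j ⟩
  queryV  : ∀ {P x k i j} →
            Step Support fP fV ⟨ P , query x k , i , j ⟩
                               ⟨ P , k (fV x) , i , suc j ⟩
  toP     : ∀ {k μ V i j} →
            Step Support fP fV ⟨ hear k , tell μ V , i , j ⟩
                               ⟨ k μ , V , i , j ⟩
  toV     : ∀ {μ P k i j} →
            Step Support fP fV ⟨ say μ P , listen k , i , j ⟩
                               ⟨ P , k μ , i , j ⟩

-- s is reachable, under some outcome of the coins, when P interacts with V.
Reachable : ∀ {X S : Set} {m} → (X → Set) → (X → S) → (X → S) →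
            Prover X S m → Verifier X S m → State X S m → Set₁
Reachable Support fP fV P V s =
  Star (Step Support fP fV) ⟨ P , V , 0 , 0 ⟩ s

------------------------------------------------------------------------
-- The honest prover

module HonestProver (K N : ℕ) .{{_ : NonZero K}} where

  private
    X = Fin N
    S = 𝒮 K

  total : ∀ {n} → Vec S n → ℚ
  total ps = foldr′ ℚ._+_ 0ℚ (map (val K) ps)

  update : (X → Maybe S) → X → S → X → Maybe S
  update known x v y = if does (y ≟ᶠ x) then just v else known y

  -- Evaluates the points of a sequence, reusing the values already known.
  evaluate : ∀ {m n} → (X → Maybe S) → Vec X n →
             (Vec S n → Prover X S m) → Prover X S m
  evaluate known []       k = k []
  evaluate known (x ∷ xs) k with known x
  ... | just v  = evaluate known xs (k ∘ (v ∷_))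
  ... | nothing = query x λ v →
                    evaluate (update known x v) xs (k ∘ (v ∷_))

  descend : ∀ {m n} → BalancedTree n → Vec S n → Prover X S m → Prover X S m
  descend leaf                 ps k = k
  descend (node {a} {b} _ l r) ps k =
    say (children (total (take a ps)) (total (drop a ps))) (hear λ
      { (reveal left)  → descend l (take a ps) k
      ; (reveal right) → descend r (drop a ps) k
      ; (sample _)     → stop
      })

  descents : ∀ {m} → BalancedTree m → ℕ → Vec S m → Prover X S m
  descents 𝒯 zero    ps = stop
  descents 𝒯 (suc t) ps = descend 𝒯 ps (descents 𝒯 t ps)

  honest : ∀ {m} → BalancedTree m → ℕ → Prover X S m
  honest 𝒯 q = hear λ
    { (sample xs) → evaluate (λ _ → nothing) xs λ ps →
                      say (root (total ps)) (descents 𝒯 q ps)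
    ; (reveal _)  → stop
    }

------------------------------------------------------------------------
-- The verifier

-- RootOK W and FinalOK z are the root check on the claim W and the final
-- acceptance condition on the number z of mismatches.
module HonestVerifier (K N : ℕ) .{{_ : NonZero K}}
                      (RootOK : ℚ → Set) (FinalOK : ℕ → Set) where

  private
    X = Fin N
    S = 𝒮 K

  drawMany : ∀ {m} n → (Vec X n → Verifier X S m) → Verifier X S m
  drawMany zero    k = k []
  drawMany (suc n) k = draw λ x → drawMany n (k ∘ (x ∷_))

  -- Follows the path to J from an interval with claim A, and passes the
  -- claim at the singleton {J} on.
  descend : ∀ {m n} → BalancedTree n → Fin n → ℚ →
            (ℚ → Verifier X S m) → Verifier X S m
  descend leaf                 J A k = k A
  descend (node {a} {b} _ l r) J A k = listen λ
    { (children A₀ A₁) →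
        test (InRange K a A₀ × InRange K b A₁ × A₀ ℚ.+ A₁ ≡ A)
          (continue A₀ A₁ (splitAt a J))
          reject
    ; (root _) → reject
    }
    where
    continue : ℚ → ℚ → Fin a ⊎ Fin b → Verifier X S _
    continue A₀ A₁ (inj₁ J₀) = tell (reveal left)  (descend l J₀ A₀ k)
    continue A₀ A₁ (inj₂ J₁) = tell (reveal right) (descend r J₁ A₁ k)

  -- The remaining t descents, z mismatches having been found so far.
  descents : ∀ {m} → BalancedTree m → Vec X m → ℚ → (t z : ℕ) → Verifier X S m
  descents     𝒯 xs W zero    z = test (FinalOK z) accept reject
  descents {m} 𝒯 xs W (suc t) z =
    uniform m λ J →
    descend 𝒯 J W λ A →
    query (lookup xs J) λ v →
    uniform K λ u →
    descents 𝒯 xs W t (z ℕ.+ compare K A (val K v) u)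

  verifier : ∀ {m} → BalancedTree m → ℕ → Verifier X S m
  verifier {m} 𝒯 q = drawMany m λ xs → tell (sample xs) (listen λ
    { (root W) → test (InRange K m W × RootOK W) (descents 𝒯 xs W q 0) reject
    ; (children _ _) → reject
    })

------------------------------------------------------------------------
-- The promise problem and the protocol

module _ (ℝ : Reals) where
  open Reals ℝ
  open RealOperations ℝ
  open Sum semiring using (sum)

  weight : ∀ {N} → (Fin N → Carrier) → Subset N → Carrier
  weight D B = sum λ x → if does (x ∈? B) then D x else 0#

  record Setting : Set where
    field
      K N     : ℕ
      {{K≥1}} : NonZero K

    X : Set
    X = Fin N

    field
      D    : X → Carrier
      D≥0  : ∀ x → 0# ≤ D x
      ∑D≈1 : sum D ≈ 1#

      fP fV : X → 𝒮 K

      εc εf : Carrier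
      0≤εc  : 0# ≤ εc
      εc<εf : εc < εf
      εf≤1  : εf ≤ 1#

      ρ γ : Carrier
      0≤ρ : 0# ≤ ρ
      ρ≤1 : ρ ≤ 1#
      0≤γ : 0# ≤ γ
      γ≤1 : γ ≤ 1#

      mismatch : Σ (Subset N) λ B → weight D B ≤ ρ ×
        (∀ x → x ∉ B → ∣ fromℚ (val K (fP x)) - fromℚ (val K (fV x)) ∣≤ γ)

      σ   : Carrier
      0≤σ : 0# ≤ σ
      σ≤1 : σ ≤ 1#

    g κ η : Carrier
    g = εf - εc
    κ = ρ + (1# - ρ) * γ
    η = g - fromℕ 2 * κ

    0<g : 0# < g
    0<g = x<y⇒0<y-x εc<εf

  module Protocol (setting : Setting) {m : ℕ} (𝒯 : BalancedTree m) (q : ℕ) where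
    open Setting setting

    a : Carrier
    a = η ÷ fromℕ 8 [ fromℕ-pos 8 ]

    RootOK : ℚ → Set
    RootOK W =
      ∣ fromℚ W ÷ fromℕ m [ fromℕ-pos m {{size-nonZero 𝒯}} ] - σ ∣≤ εc + a

    FinalOK : ℕ → Set
    FinalOK z = fromℕ z ≤ (g * fromℕ q) ÷ fromℕ 2 [ fromℕ-pos 2 ]

    honestProver : Prover X (𝒮 K) m
    honestProver = HonestProver.honest K N 𝒯 q

    verifier : Verifier X (𝒮 K) m
    verifier = HonestVerifier.verifier K N RootOK FinalOK 𝒯 q

    ReachableWith : Prover X (𝒮 K) m → State X (𝒮 K) m → Set₁
    ReachableWith P = Reachable (λ x → 0# < D x) fP fV P verifier

{-# OPTIONS --safe #-}

-- In every interaction the honest prover makes at most m evaluations and the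
-- verifier at most q, so only the two ceilings need to be bounded.  Let L < n
-- with n a natural number and e = (1 - 2c) g.  From 0 ≤ κ ≤ c g we get
-- 0 < e ≤ η ≤ g ≤ 1, hence e² ≤ η² and e² ≤ g ≤ 1.  As ⌈x/η²⌉ < x/η² + 1,
--   m e² ≤ 32 n + e² ≤ 32 n + 1,   q e² ≤ 24 g n + e² ≤ (32 n + 1) g,
-- so C = 32 n + 1 works.
module Submission where

open import Defs
open import Algebra.Bundles using (CommutativeRing; Ring)
import Algebra.Properties.Group as GroupProperties
import Algebra.Solver.Ring.NaturalCoefficients.Default as RingSolver
open import Data.Fin.Base using (Fin; splitAt)
open import Data.Integer.Base using (+_)
open import Data.Maybe.Base using (just; nothing)
open import Data.Nat.Base as ℕ using (ℕ; zero; suc; NonZero; z≤n; s≤s)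
import Data.Nat.Properties as ℕₚ
open import Data.Product.Base using (∃; _×_; _,_; proj₁; proj₂)
open import Data.Rational.Base using (ℚ; ½; _/_)
open import Data.Sum.Base using (_⊎_; inj₁; inj₂)
open import Data.Vec.Base using (Vec; []; _∷_)
open import Function.Base using (_∘_)
open import Relation.Binary.Construct.Closure.ReflexiveTransitive using (Star; ε; _◅_)
import Relation.Binary.Reasoning.Base.Triple as TripleReasoning
open import Relation.Binary.Structures using (IsPreorder; IsStrictPartialOrder)
open import Relation.Nullary.Negation.Core using (¬_; contradiction)

-- Worst-case evaluation counts of programs and their soundness for executions.

data ProverBound {X S : Set} {m : ℕ} : ℕ → Prover X S m → Set where
  stop  : ∀ {n} → ProverBound n stop
  query : ∀ {n x k} → (∀ v → ProverBound n (k v)) →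
          ProverBound (suc n) (query x k)
  hear  : ∀ {n k} → (∀ μ → ProverBound n (k μ)) → ProverBound n (hear k)
  say   : ∀ {n μ P} → ProverBound n P → ProverBound n (say μ P)

-- Only `query` spends budget. Both branches of `test` and every incoming message have to obey the
-- bound, so it does not depend on the coins or on the other party.
data VerifierBound {X S : Set} {m : ℕ} : ℕ → Verifier X S m → Set₁ where
  accept  : ∀ {n} → VerifierBound n accept
  reject  : ∀ {n} → VerifierBound n reject
  draw    : ∀ {n k} → (∀ x → VerifierBound n (k x)) → VerifierBound n (draw k)
  uniform : ∀ {n l k} → (∀ u → VerifierBound n (k u)) →
            VerifierBound n (uniform l k)
  query   : ∀ {n x k} → (∀ v → VerifierBound n (k v)) →
            VerifierBound (suc n) (query x k)
  test    : ∀ {n A V W} → VerifierBound n V → VerifierBound n W →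
            VerifierBound n (test A V W)
  tell    : ∀ {n μ V} → VerifierBound n V → VerifierBound n (tell μ V)
  listen  : ∀ {n k} → (∀ μ → VerifierBound n (k μ)) → VerifierBound n (listen k)

module _ {X S : Set} {m : ℕ} {Support : X → Set} {fP fV : X → S} where
  open State

  -- Invariant along the run: remaining budget plus evaluations made stays at most `b`. A query
  -- moves one unit from the first summand to the second, and the other steps change neither.
  proverEvals-≤ : ∀ {b n} {s t : State X S m} →
                  ProverBound n (prover s) → n ℕ.+ proverEvals s ℕ.≤ b →
                  Star (Step Support fP fV) s t → proverEvals t ℕ.≤ b
  proverEvals-≤ {n = n} _ n+i≤b ε = ℕₚ.≤-trans (ℕₚ.m≤n+m _ n) n+i≤b
  proverEvals-≤ p         n+i≤b (draw _ _ ◅ r)      = proverEvals-≤ p n+i≤b r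
  proverEvals-≤ p         n+i≤b (uniform _ ◅ r)     = proverEvals-≤ p n+i≤b r
  proverEvals-≤ p         n+i≤b (pass _ ◅ r)        = proverEvals-≤ p n+i≤b r
  proverEvals-≤ p         n+i≤b (fail _ ◅ r)        = proverEvals-≤ p n+i≤b r
  proverEvals-≤ (query {n} p) n+i≤b (queryP ◅ r)    =
    proverEvals-≤ (p _) (ℕₚ.≤-trans (ℕₚ.≤-reflexive (ℕₚ.+-suc n _)) n+i≤b) r
  proverEvals-≤ p         n+i≤b (queryV ◅ r)        = proverEvals-≤ p n+i≤b r
  proverEvals-≤ (hear p)  n+i≤b (toP ◅ r)           = proverEvals-≤ (p _) n+i≤b r
  proverEvals-≤ (say p)   n+i≤b (toV ◅ r)           = proverEvals-≤ p n+i≤b r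

  verifierEvals-≤ : ∀ {b n} {s t : State X S m} →
                    VerifierBound n (verifier s) → n ℕ.+ verifierEvals s ℕ.≤ b →
                    Star (Step Support fP fV) s t → verifierEvals t ℕ.≤ b
  verifierEvals-≤ {n = n} _ n+j≤b ε = ℕₚ.≤-trans (ℕₚ.m≤n+m _ n) n+j≤b
  verifierEvals-≤ (draw p)    n+j≤b (draw _ _ ◅ r)  = verifierEvals-≤ (p _) n+j≤b r
  verifierEvals-≤ (uniform p) n+j≤b (uniform _ ◅ r) = verifierEvals-≤ (p _) n+j≤b r
  verifierEvals-≤ (test p _)  n+j≤b (pass _ ◅ r)    = verifierEvals-≤ p n+j≤b r
  verifierEvals-≤ (test _ p)  n+j≤b (fail _ ◅ r)    = verifierEvals-≤ p n+j≤b r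
  verifierEvals-≤ p           n+j≤b (queryP ◅ r)    = verifierEvals-≤ p n+j≤b r
  verifierEvals-≤ (query {n} p) n+j≤b (queryV ◅ r)  =
    verifierEvals-≤ (p _) (ℕₚ.≤-trans (ℕₚ.≤-reflexive (ℕₚ.+-suc n _)) n+j≤b) r
  verifierEvals-≤ (tell p)    n+j≤b (toP ◅ r)       = verifierEvals-≤ p n+j≤b r
  verifierEvals-≤ (listen p)  n+j≤b (toV ◅ r)       = verifierEvals-≤ (p _) n+j≤b r

-- Allows slack in the budget, as is needed when a sampled point repeats and is not evaluated again.
ProverBound-suc : ∀ {X S m n} {P : Prover X S m} →
                  ProverBound n P → ProverBound (suc n) P
ProverBound-suc stop      = stop
ProverBound-suc (query p) = query λ v → ProverBound-suc (p v)
ProverBound-suc (hear p)  = hear λ μ → ProverBound-suc (p μ)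
ProverBound-suc (say p)   = say (ProverBound-suc p)

-- The honest prover: all evaluations happen while the sample is processed.

module _ (K N : ℕ) .{{_ : NonZero K}} where
  open HonestProver K N

  -- One unit is reserved per sample position. The table `known` is arbitrary because it grows
  -- during the induction.
  evaluate-bound : ∀ {m n} known (xs : Vec (Fin N) n)
                   {k : Vec (𝒮 K) n → Prover (Fin N) (𝒮 K) m} →
                   (∀ ps → ProverBound 0 (k ps)) →
                   ProverBound n (evaluate known xs k)
  evaluate-bound known []       k-bound = k-bound []
  evaluate-bound known (x ∷ xs) k-bound with known x
  -- A stored value costs nothing, so the unit reserved for this position stays unspent.
  ... | just v  = ProverBound-suc (evaluate-bound known xs (k-bound ∘ (v ∷_)))
  ... | nothing = query λ v →
    evaluate-bound (update known x v) xs (k-bound ∘ (v ∷_))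

  -- Child claims are partial sums of stored values, so they cost no evaluation.
  descend-bound : ∀ {m n} (𝒯 : BalancedTree n) (ps : Vec (𝒮 K) n)
                  {P : Prover (Fin N) (𝒮 K) m} →
                  ProverBound 0 P → ProverBound 0 (descend 𝒯 ps P)
  descend-bound leaf         ps p = p
  descend-bound (node _ l r) ps p = say (hear λ
    { (reveal left)  → descend-bound l _ p
    ; (reveal right) → descend-bound r _ p
    ; (sample _)     → stop
    })

  descents-bound : ∀ {m} (𝒯 : BalancedTree m) q ps →
                   ProverBound 0 (descents 𝒯 q ps)
  descents-bound 𝒯 zero    ps = stop
  descents-bound 𝒯 (suc t) ps = descend-bound 𝒯 ps (descents-bound 𝒯 t ps)

  honest-bound : ∀ {m} (𝒯 : BalancedTree m) q → ProverBound m (honest 𝒯 q)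
  honest-bound 𝒯 q = hear λ
    { (sample xs) → evaluate-bound _ xs λ ps → say (descents-bound 𝒯 q ps)
    ; (reveal _)  → stop
    }

-- HonestVerifier.descend hides the continuation of its listen in a where
-- block; reply makes it available to types.
reply : ∀ {X S m} → Verifier X S m → ProverMessage → Verifier X S m
reply (listen k) = k
reply V          = λ _ → V

-- The verifier: one evaluation per completed descent.

module _ (K N : ℕ) .{{_ : NonZero K}} (RootOK : ℚ → Set) (FinalOK : ℕ → Set) where
  open HonestVerifier K N RootOK FinalOK

  drawMany-bound : ∀ {m b} n {k : Vec (Fin N) n → Verifier (Fin N) (𝒮 K) m} →
                   (∀ xs → VerifierBound b (k xs)) →
                   VerifierBound b (drawMany n k)
  drawMany-bound zero    k-bound = k-bound []
  drawMany-bound (suc n) k-bound =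
    draw λ x → drawMany-bound n (k-bound ∘ (x ∷_))

  -- Walking down the tree only exchanges and checks claims, so the whole budget reaches the
  -- continuation, whatever claims the prover makes.
  descendᵛ-bound : ∀ {m n b} (𝒯 : BalancedTree n) J A
                   {k : ℚ → Verifier (Fin N) (𝒮 K) m} →
                   (∀ A → VerifierBound b (k A)) →
                   VerifierBound b (descend 𝒯 J A k)
  descendᵛ-bound leaf J A k-bound = k-bound A
  descendᵛ-bound {b = b} (node {a} e l r) J A {k} k-bound = listen reply-bound
    where
    reply-bound : ∀ μ → VerifierBound b (reply (descend (node e l r) J A k) μ)
    reply-bound (root _)         = reject
    reply-bound (children A₀ A₁) with splitAt a J
    -- Splitting on the verifier's own `splitAt a J` lets its hidden `continue` reduce in the goal.
    ... | inj₁ J₀ = test (tell (descendᵛ-bound l J₀ A₀ k-bound)) reject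
    ... | inj₂ J₁ = test (tell (descendᵛ-bound r J₁ A₁ k-bound)) reject

  descentsᵛ-bound : ∀ {m} (𝒯 : BalancedTree m) xs W t z →
                    VerifierBound t (descents 𝒯 xs W t z)
  descentsᵛ-bound 𝒯 xs W zero    z = test accept reject
  descentsᵛ-bound 𝒯 xs W (suc t) z =
    uniform λ J → descendᵛ-bound 𝒯 J W λ A →
    query λ v → uniform λ u → descentsᵛ-bound 𝒯 xs W t _

  verifier-bound : ∀ {m} (𝒯 : BalancedTree m) q →
                   VerifierBound q (verifier 𝒯 q)
  verifier-bound {m} 𝒯 q = drawMany-bound m λ xs → tell (listen λ
    { (root W)       → test (descentsᵛ-bound 𝒯 xs W q 0) reject
    ; (children _ _) → reject
    })

-- Ordered-field arithmetic without a decidable order.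

module OrderedField (ℝ : Reals) where
  open Reals ℝ
  open RealOperations ℝ
  open IsStrictPartialOrder isStrictPartialOrder
    using (irrefl; asym; <-resp-≈; <-respˡ-≈) renaming (trans to <-trans)
  open Ring ring using (+-group)
  open GroupProperties +-group using (//-rightDividesˡ; //-rightDividesʳ)
  open RingSolver (CommutativeRing.commutativeSemiring commutativeRing)
    using (solve; _:=_; _:+_; _:*_)

  ≤-reflexive : ∀ {x y} → x ≈ y → x ≤ y
  ≤-reflexive x≈y = irrefl (sym x≈y)

  ≤-trans : ∀ {x y z} → x ≤ y → y ≤ z → x ≤ z
  ≤-trans x≤y y≤z z<x = x≤y (≤-<-trans y≤z z<x)

  -- Cotransitivity stands in for trichotomy: `z` is apart from `x` or from `y`, and each resulting
  -- order either yields `x < z` or contradicts `y ≤ z`.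
  <-≤-trans : ∀ {x y z} → x < y → y ≤ z → x < z
  <-≤-trans {x} {y} {z} x<y y≤z with #-cotrans (<⇒# x<y) z
  ... | inj₁ x#z with #⇒<⊎> x#z
  ...   | inj₁ x<z = x<z
  ...   | inj₂ z<x = contradiction (<-trans z<x x<y) y≤z
  <-≤-trans {x} {y} {z} x<y y≤z | inj₂ z#y with #⇒<⊎> z#y
  ...   | inj₁ z<y = contradiction z<y y≤z
  ...   | inj₂ y<z = <-trans x<y y<z

  ≤-isPreorder : IsPreorder _≈_ _≤_
  ≤-isPreorder = record
    { isEquivalence = isEquivalence
    ; reflexive     = ≤-reflexive
    ; trans         = ≤-trans
    }

  open TripleReasoning ≤-isPreorder asym <-trans <-resp-≈ asym <-≤-trans ≤-<-trans

  -- As `≤` is a negated `<`, this cancellation law is what gives monotonicity of addition for `≤`,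
  -- by contraposition.
  +-cancelʳ-< : ∀ {x y} z → x + z < y + z → x < y
  +-cancelʳ-< {x} {y} z x+z<y+z = begin-strict
    x            ≈⟨ //-rightDividesʳ z x ⟨
    (x + z) - z  <⟨ +-monoˡ-< (- z) x+z<y+z ⟩
    (y + z) - z  ≈⟨ //-rightDividesʳ z y ⟩
    y            ∎

  +-monoˡ-≤ : ∀ {x y} z → x ≤ y → x + z ≤ y + z
  +-monoˡ-≤ z x≤y = x≤y ∘ +-cancelʳ-< z

  +-monoʳ-≤ : ∀ {x y} z → x ≤ y → z + x ≤ z + y
  +-monoʳ-≤ {x} {y} z x≤y = begin
    z + x  ≈⟨ +-comm z x ⟩
    x + z  ≤⟨ +-monoˡ-≤ z x≤y ⟩
    y + z  ≈⟨ +-comm y z ⟩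
    z + y  ∎

  +-mono-≤ : ∀ {w x y z} → w ≤ x → y ≤ z → w + y ≤ x + z
  +-mono-≤ {x = x} {y} w≤x y≤z = ≤-trans (+-monoˡ-≤ y w≤x) (+-monoʳ-≤ x y≤z)

  x≤x+y : ∀ {x y} → 0# ≤ y → x ≤ x + y
  x≤x+y {x} {y} 0≤y = begin
    x       ≈⟨ +-identityʳ x ⟨
    x + 0#  ≤⟨ +-monoʳ-≤ x 0≤y ⟩
    x + y   ∎

  +-nonNeg : ∀ {x y} → 0# ≤ x → 0# ≤ y → 0# ≤ x + y
  +-nonNeg 0≤x 0≤y = ≤-trans 0≤x (x≤x+y 0≤y)

  nonNeg+pos⇒pos : ∀ {x y} → 0# ≤ x → 0# < y → 0# < x + y
  nonNeg+pos⇒pos {x} {y} 0≤x 0<y = begin-strict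
    0#     <⟨ 0<y ⟩
    y      ≤⟨ x≤x+y 0≤x ⟩
    y + x  ≈⟨ +-comm y x ⟩
    x + y  ∎

  x≤y+z⇒x-z≤y : ∀ {x y} z → x ≤ y + z → x - z ≤ y
  x≤y+z⇒x-z≤y {x} {y} z x≤y+z = begin
    x - z        ≤⟨ +-monoˡ-≤ (- z) x≤y+z ⟩
    (y + z) - z  ≈⟨ //-rightDividesʳ z y ⟩
    y            ∎

  x+z≤y⇒x≤y-z : ∀ {x y} z → x + z ≤ y → x ≤ y - z
  x+z≤y⇒x≤y-z {x} {y} z x+z≤y = begin
    x            ≈⟨ //-rightDividesʳ z x ⟨
    (x + z) - z  ≤⟨ +-monoˡ-≤ (- z) x+z≤y ⟩
    y - z        ∎

  x≤y⇒0≤y-x : ∀ {x y} → x ≤ y → 0# ≤ y - x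
  x≤y⇒0≤y-x {x} {y} x≤y = x+z≤y⇒x≤y-z x (≤-trans (≤-reflexive (+-identityˡ x)) x≤y)

  -- The substitute for the case distinction x < y ⊎ x ≈ y, which is not
  -- available because the order is not decidable.
  ≤-≯⇒≈ : ∀ {x y} → x ≤ y → ¬ (x < y) → x ≈ y
  ≤-≯⇒≈ {x} {y} x≤y x≮y = proj₁ (tight x y) λ x#y → case# (#⇒<⊎> x#y)
    where
    case# : ¬ (x < y ⊎ y < x)
    case# (inj₁ x<y) = x≮y x<y
    case# (inj₂ y<x) = x≤y y<x

  -- The goal is a negation, so nested refutations replace a case split. Given `x * y < 0#`, a
  -- positive `x` excludes a positive `y` and forces `y ≈ 0#`, which is absurd; hence `x ≈ 0#`,
  -- equally absurd.
  *-nonNeg : ∀ {x y} → 0# ≤ x → 0# ≤ y → 0# ≤ x * y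
  *-nonNeg {x} {y} 0≤x 0≤y xy<0 = irrefl
    (trans (*-congʳ (sym (≤-≯⇒≈ 0≤x x≯0))) (zeroˡ y)) xy<0
    where
    x≯0 : ¬ (0# < x)
    x≯0 0<x = irrefl (trans (*-congˡ (sym (≤-≯⇒≈ 0≤y y≯0))) (zeroʳ x)) xy<0
      where
      y≯0 : ¬ (0# < y)
      y≯0 0<y = asym (*-pos 0<x 0<y) xy<0

  *-monoˡ-≤ : ∀ {x y z} → 0# ≤ z → x ≤ y → x * z ≤ y * z
  *-monoˡ-≤ {x} {y} {z} 0≤z x≤y = begin
    x * z                ≈⟨ +-identityˡ (x * z) ⟨
    0# + x * z           ≤⟨ +-monoˡ-≤ (x * z) (*-nonNeg (x≤y⇒0≤y-x x≤y) 0≤z) ⟩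
    (y - x) * z + x * z  ≈⟨ distribʳ z (y - x) x ⟨
    ((y - x) + x) * z    ≈⟨ *-congʳ (//-rightDividesˡ x y) ⟩
    y * z                ∎

  *-monoʳ-≤ : ∀ {x y z} → 0# ≤ z → x ≤ y → z * x ≤ z * y
  *-monoʳ-≤ {x} {y} {z} 0≤z x≤y = begin
    z * x  ≈⟨ *-comm z x ⟩
    x * z  ≤⟨ *-monoˡ-≤ 0≤z x≤y ⟩
    y * z  ≈⟨ *-comm y z ⟩
    z * y  ∎

  *-mono-≤ : ∀ {w x y z} → 0# ≤ x → 0# ≤ y → w ≤ x → y ≤ z → w * y ≤ x * z
  *-mono-≤ 0≤x 0≤y w≤x y≤z = ≤-trans (*-monoˡ-≤ 0≤y w≤x) (*-monoʳ-≤ 0≤x y≤z)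

  *-cancelʳ-≤-pos : ∀ {x y z} → 0# < z → x * z ≤ y * z → x ≤ y
  *-cancelʳ-≤-pos 0<z xz≤yz y<x = xz≤yz (*-monoˡ-<-pos 0<z y<x)

  fromℕ-nonNeg : ∀ n → 0# ≤ fromℕ n
  fromℕ-nonNeg zero    = irrefl refl
  fromℕ-nonNeg (suc n) = +-nonNeg (asym 0<1) (fromℕ-nonNeg n)

  fromℕ-mono-≤ : ∀ {m n} → m ℕ.≤ n → fromℕ m ≤ fromℕ n
  fromℕ-mono-≤ {n = n} z≤n = fromℕ-nonNeg n
  fromℕ-mono-≤ (s≤s m≤n)   = +-monoʳ-≤ 1# (fromℕ-mono-≤ m≤n)

  ÷-*-cancel : ∀ x {y} (0<y : 0# < y) → x ÷ y [ 0<y ] * y ≈ x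
  ÷-*-cancel x {y} 0<y =
    trans (*-assoc x _ y) (trans (*-congˡ (recip-inverse y 0<y)) (*-identityʳ x))

  x*z≤y⇒x≤y÷z : ∀ {x y z} (0<z : 0# < z) → x * z ≤ y → x ≤ y ÷ z [ 0<z ]
  x*z≤y⇒x≤y÷z {y = y} 0<z xz≤y = *-cancelʳ-≤-pos 0<z
    (≤-trans xz≤y (≤-reflexive (sym (÷-*-cancel y 0<z))))

  -- Rounding up adds less than one, so the predecessor of the ceiling times `E` is below `x`. A
  -- ceiling of zero has no predecessor, but then the left side vanishes.
  ceiling-*-≤ : ∀ {x y D E} (0<E : 0# < E) k → IsCeiling (x ÷ E [ 0<E ]) k →
                0# ≤ D → D ≤ E → 0# ≤ y → x ≤ y → fromℕ k * D ≤ y + D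
  ceiling-*-≤ {D = D} 0<E zero _ 0≤D D≤E 0≤y x≤y =
    ≤-trans (≤-reflexive (zeroˡ D)) (+-nonNeg 0≤y 0≤D)
  ceiling-*-≤ {x} {y} {D} {E} 0<E (suc k) (_ , 1+k<x÷E+1) 0≤D D≤E 0≤y x≤y = begin
    (1# + fromℕ k) * D        ≈⟨ distribʳ D 1# (fromℕ k) ⟩
    1# * D + fromℕ k * D      ≈⟨ +-congʳ (*-identityˡ D) ⟩
    D + fromℕ k * D           ≤⟨ +-monoʳ-≤ D (*-monoʳ-≤ (fromℕ-nonNeg k) D≤E) ⟩
    D + fromℕ k * E           ≤⟨ +-monoʳ-≤ D (asym (*-monoˡ-<-pos 0<E k<x÷E)) ⟩
    D + x ÷ E [ 0<E ] * E     ≈⟨ +-congˡ (÷-*-cancel x 0<E) ⟩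
    D + x                     ≤⟨ +-monoʳ-≤ D x≤y ⟩
    D + y                     ≈⟨ +-comm D y ⟩
    y + D                     ∎
    where
    k<x÷E : fromℕ k < x ÷ E [ 0<E ]
    k<x÷E = +-cancelʳ-< 1# (<-respˡ-≈ (+-comm 1# (fromℕ k)) 1+k<x÷E+1)

  -- Comparison of the parameters and bounds for the two ceilings.

  module Bounds (c : Carrier) (c<½ : c < fromℚ ½) (setting : Setting ℝ)
                (κ≤cg : Setting.κ setting ≤ c * Setting.g setting) where
    open Setting setting

    d e : Carrier
    d = 1# - fromℕ 2 * c
    e = d * g

    0<d : 0# < d
    0<d = 1-2c-pos c<½

    0<e : 0# < e
    0<e = *-pos 0<d 0<g

    0<η : 0# < η
    0<η = g-2κ-pos c<½ 0<g κ≤cg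

    0≤κ : 0# ≤ κ
    0≤κ = +-nonNeg 0≤ρ (*-nonNeg (x≤y⇒0≤y-x ρ≤1) 0≤γ)

    g≤1 : g ≤ 1#
    g≤1 = x≤y+z⇒x-z≤y εc (≤-trans εf≤1 (x≤x+y 0≤εc))

    η≤g : η ≤ g
    η≤g = x≤y+z⇒x-z≤y (fromℕ 2 * κ) (x≤x+y (*-nonNeg (fromℕ-nonNeg 2) 0≤κ))

    -- Here the mismatch bound enters: it gives e + 2κ ≤ (1 - 2c) g + 2cg = g.
    e≤η : e ≤ η
    e≤η = x+z≤y⇒x≤y-z (fromℕ 2 * κ) (begin
      d * g + fromℕ 2 * κ        ≤⟨ +-monoʳ-≤ (d * g) (*-monoʳ-≤ (fromℕ-nonNeg 2) κ≤cg) ⟩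
      d * g + fromℕ 2 * (c * g)  ≈⟨ solve 4 (λ d g t c → d :* g :+ t :* (c :* g) := (d :+ t :* c) :* g)
                                      refl d g (fromℕ 2) c ⟩
      (d + fromℕ 2 * c) * g      ≈⟨ *-congʳ (//-rightDividesˡ (fromℕ 2 * c) 1#) ⟩
      1# * g                     ≈⟨ *-identityˡ g ⟩
      g                          ∎)

    e≤g : e ≤ g
    e≤g = ≤-trans e≤η η≤g

    0≤e : 0# ≤ e
    0≤e = asym 0<e

    e²≤η² : e * e ≤ η * η
    e²≤η² = *-mono-≤ (asym 0<η) 0≤e e≤η e≤η

    -- Absorbs the rounding error of the ceilings: into `g` for the descents, where a factor `g` has
    -- to be split off, and through `g≤1` into 1 for the sample.
    e²≤g : e * e ≤ g
    e²≤g = begin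
      e * e   ≤⟨ *-monoˡ-≤ 0≤e (≤-trans e≤g g≤1) ⟩
      1# * e  ≈⟨ *-identityˡ e ⟩
      e       ≤⟨ e≤g ⟩
      g       ∎

    module _ {L ℓ : Carrier} (0≤ℓ : 0# ≤ ℓ) (L≤ℓ : L ≤ ℓ) where

      C : Carrier
      C = fromℕ 32 * ℓ + 1#

      sampleSize-≤ : ∀ m → IsCeiling ((fromℕ 32 * L) ÷ (η * η) [ *-pos 0<η 0<η ]) m →
                     fromℕ m ≤ C ÷ (d * d) [ *-pos 0<d 0<d ] ÷ (g * g) [ *-pos 0<g 0<g ]
      sampleSize-≤ m m-ceil =
        x*z≤y⇒x≤y÷z (*-pos 0<g 0<g) (x*z≤y⇒x≤y÷z (*-pos 0<d 0<d) (begin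
          fromℕ m * (g * g) * (d * d)
            ≈⟨ solve 3 (λ m g d → m :* (g :* g) :* (d :* d) := m :* ((d :* g) :* (d :* g)))
                 refl (fromℕ m) g d ⟩
          fromℕ m * (e * e)
            ≤⟨ ceiling-*-≤ (*-pos 0<η 0<η) m m-ceil (*-nonNeg 0≤e 0≤e) e²≤η²
                 (*-nonNeg (fromℕ-nonNeg 32) 0≤ℓ) (*-monoʳ-≤ (fromℕ-nonNeg 32) L≤ℓ) ⟩
          fromℕ 32 * ℓ + e * e
            ≤⟨ +-monoʳ-≤ _ (≤-trans e²≤g g≤1) ⟩
          C ∎))

      descentCount-≤ : ∀ q → IsCeiling ((fromℕ 24 * g * L) ÷ (η * η) [ *-pos 0<η 0<η ]) q →
                       fromℕ q ≤ C ÷ (d * d) [ *-pos 0<d 0<d ] ÷ g [ 0<g ]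
      descentCount-≤ q q-ceil =
        -- Clearing denominators leaves only one factor `g`. A second one completes `e * e` on the
        -- left and is matched on the right by the `g` in the numerator of the descent count.
        x*z≤y⇒x≤y÷z 0<g (x*z≤y⇒x≤y÷z (*-pos 0<d 0<d) (*-cancelʳ-≤-pos 0<g (begin
          fromℕ q * g * (d * d) * g
            ≈⟨ solve 3 (λ q g d → q :* g :* (d :* d) :* g := q :* ((d :* g) :* (d :* g)))
                 refl (fromℕ q) g d ⟩
          fromℕ q * (e * e)
            ≤⟨ ceiling-*-≤ (*-pos 0<η 0<η) q q-ceil (*-nonNeg 0≤e 0≤e) e²≤η²
                 (*-nonNeg 0≤24g 0≤ℓ) (*-monoʳ-≤ 0≤24g L≤ℓ) ⟩
          fromℕ 24 * g * ℓ + e * e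
            ≤⟨ +-mono-≤ (*-monoˡ-≤ 0≤ℓ (*-monoˡ-≤ (asym 0<g)
                 (fromℕ-mono-≤ {24} {32} (ℕₚ.m≤m+n 24 8)))) e²≤g ⟩
          fromℕ 32 * g * ℓ + g
            ≈⟨ +-congˡ (*-identityˡ g) ⟨
          fromℕ 32 * g * ℓ + 1# * g
            ≈⟨ solve 4 (λ t g l u → t :* g :* l :+ u :* g := (t :* l :+ u) :* g)
                 refl (fromℕ 32) g ℓ 1# ⟩
          C * g ∎)))
        where
        0≤24g : 0# ≤ fromℕ 24 * g
        0≤24g = *-nonNeg (fromℕ-nonNeg 24) (asym 0<g)

-- Evaluation counts combined with the ceiling bounds.

corollary4p17 :
    (ℝ : Reals) →
    let open Reals ℝ
        open RealOperations ℝ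
    in
    (δ : Carrier) (0<δ : 0# < δ) → δ < fromℚ (+ 1 / 3) →
    (L : Carrier) → IsLn (fromℕ 12 ÷ δ [ 0<δ ]) L →
    ∃ λ (C : Carrier) → 0# < C ×
      ((c : Carrier) (c<½ : c < fromℚ ½) →
       (setting : Setting ℝ) →
       let open Setting setting in
       (κ≤cg : κ ≤ c * g) →
       let 0<η    = g-2κ-pos c<½ 0<g κ≤cg
           0<1-2c = 1-2c-pos c<½
           C/[1-2c]² = C ÷ ((1# - fromℕ 2 * c) * (1# - fromℕ 2 * c)) [ *-pos 0<1-2c 0<1-2c ]
       in
       (m q : ℕ) →
       IsCeiling ((fromℕ 32 * L) ÷ (η * η) [ *-pos 0<η 0<η ]) m →
       IsCeiling ((fromℕ 24 * g * L) ÷ (η * η) [ *-pos 0<η 0<η ]) q →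
       (𝒯 : BalancedTree m) →
       let open Protocol ℝ setting 𝒯 q
           open State
       in
       (∀ s → ReachableWith honestProver s →
          fromℕ (proverEvals s) ≤ C/[1-2c]² ÷ (g * g) [ *-pos 0<g 0<g ]) ×
       (∀ P s → ReachableWith P s →
          fromℕ (verifierEvals s) ≤ C/[1-2c]² ÷ g [ 0<g ]))
-- The witness is built from `L` alone, before `c` and the setting are given, so it is uniform in
-- both.
corollary4p17 ℝ δ 0<δ _ L _ = fromℕ 32 * ℓ + 1# , 0<C ,
  λ c c<½ setting κ≤cg m q m-ceil q-ceil 𝒯 →
    let open Setting setting
        open Protocol ℝ setting 𝒯 q
        open Bounds c c<½ setting κ≤cg
    in
    (λ s r → ≤-trans
      (fromℕ-mono-≤ (proverEvals-≤ (honest-bound K N 𝒯 q) (ℕₚ.≤-reflexive (ℕₚ.+-identityʳ m)) r))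
      (sampleSize-≤ 0≤ℓ L≤ℓ m m-ceil)) ,
    -- Only the verifier's program is inspected, so `P` may deviate arbitrarily.
    (λ P s r → ≤-trans
      (fromℕ-mono-≤ (verifierEvals-≤ (verifier-bound K N RootOK FinalOK 𝒯 q)
        (ℕₚ.≤-reflexive (ℕₚ.+-identityʳ q)) r))
      (descentCount-≤ 0≤ℓ L≤ℓ q q-ceil))
  where
  open Reals ℝ
  open RealOperations ℝ
  open OrderedField ℝ
  open IsStrictPartialOrder isStrictPartialOrder using (asym)

  -- A natural number above `L` is an upper bound that is nonnegative by construction.
  n : ℕ
  n = proj₁ (archimedean L)

  ℓ : Carrier
  ℓ = fromℕ n

  0≤ℓ : 0# ≤ ℓ
  0≤ℓ = fromℕ-nonNeg n

  L≤ℓ : L ≤ ℓ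
  L≤ℓ = asym (proj₂ (archimedean L))

  0<C : 0# < fromℕ 32 * ℓ + 1#
  0<C = nonNeg+pos⇒pos (*-nonNeg (fromℕ-nonNeg 32) 0≤ℓ) 0<1
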